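{- Let $D=(E,\mathcal F)$ be a proper set system. Then there exists a feasible set $F\in\mathcal F$ such that $$\omega(D^{\ast\times|F})=\max_{B\subseteq E}\omega(D^{\ast\times|B}).$$
   Context: A set system is a pair $D=(E,\mathcal F)$ with $E$ a finite set and $\mathcal F\subseteq 2^E$; the members of $\mathcal F$ are the feasible sets of $D$, also denoted $\mathcal F(D)$. $D$ is proper if $\mathcal F\neq\emptyset$. For proper $D$, $r(D_{\max})$ and $r(D_{\min})$ denote the largest and smallest cardinality of a feasible set, and the width is $\omega(D)=r(D_{\max})-r(D_{\min})$. Twist: for $A\subseteq E$, $D^{\ast|A}=(E,\{F\triangle A\mid F\in\mathcal F\})$, where $\triangle$ is symmetric difference. Loop complementation: for $e\in E$, $D^{\times|e}=(E,\mathcal F')$ with $\mathcal F'=\mathcal F\,\triangle\,\{F\cup\{e\}\mid F\in\mathcal F,\ e\notin F\}$. Loop complementations on distinct elements commute, and for $A\subseteq E$, $D^{\times|A}$ is obtained by applying loop complementation to every element of $A$. These operations preserve properness. Words are read left to right: $D^{\ast\times|A}=(D^{\ast|A})^{\times|A}$. -}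

module Defs where

open import Data.Bool using (Bool; T; T?; _xor_; _≟_)
open import Data.Fin using (Fin)
open import Data.Fin.Subset using (Subset; inside; outside; _∪_; ⁅_⁆; ∣_∣)
open import Data.Fin.Subset.Properties using (_∈?_; anySubset?)
open import Data.List using (List; []; _∷_; _++_; allFin; filter; foldl; map)
open import Data.List.Extrema.Nat using (max; min)
open import Data.Nat using (ℕ; zero; suc; _∸_)
open import Data.Product using (∃-syntax)
import Data.Vec as Vec
open import Data.Vec.Properties using (≡-dec)
open import Relation.Binary.Definitions using (DecidableEquality)
open import Relation.Binary.PropositionalEquality using (_≡_)
open import Relation.Nullary using (Dec; does; ¬?; _×-dec_)

private
  variable
    n : ℕ

infixl 6 _△_
infixl 5 _*∣_ _×∣_ _*×∣_ _loopComplement_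
infix 4 _∈ᶠ_ _∈ᶠ?_ _≟ˢ_

_△_ : Subset n → Subset n → Subset n
_△_ = Vec.zipWith _xor_

_≟ˢ_ : DecidableEquality (Subset n)
_≟ˢ_ = ≡-dec _≟_

-- The ground set is E = Fin n; a family of subsets of E is given by its
-- characteristic function.
SetSystem : ℕ → Set
SetSystem n = Subset n → Bool

_∈ᶠ_ : Subset n → SetSystem n → Set
F ∈ᶠ D = T (D F)

_∈ᶠ?_ : (F : Subset n) (D : SetSystem n) → Dec (F ∈ᶠ D)
F ∈ᶠ? D = T? (D F)

Proper : SetSystem n → Set
Proper {n} D = ∃[ F ] F ∈ᶠ D

-- The family { F △ A | F feasible in D }.
_*∣_ : SetSystem n → Subset n → SetSystem n
(D *∣ A) X = does (anySubset? λ F → (F ∈ᶠ? D) ×-dec (X ≟ˢ F △ A))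

-- The symmetric difference (pointwise xor) of the family of feasible sets
-- with { F ∪ {e} | F feasible in D, e ∉ F }.
_loopComplement_ : SetSystem n → Fin n → SetSystem n
(D loopComplement e) X =
  D X xor
  does (anySubset? λ F → (F ∈ᶠ? D) ×-dec ¬? (e ∈? F) ×-dec (X ≟ˢ F ∪ ⁅ e ⁆))

-- Loop complementations on distinct elements commute, so processing the
-- elements of A in increasing order is a harmless choice.
_×∣_ : SetSystem n → Subset n → SetSystem n
_×∣_ {n} D A = foldl _loopComplement_ D (filter (_∈? A) (allFin n))

_*×∣_ : SetSystem n → Subset n → SetSystem n
D *×∣ A = (D *∣ A) ×∣ A

subsets : ∀ n → List (Subset n)
subsets zero    = Vec.[] ∷ []
subsets (suc n) = map (outside Vec.∷_) (subsets n) ++ map (inside Vec.∷_) (subsets n)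

feasibleSizes : SetSystem n → List ℕ
feasibleSizes {n} D = map ∣_∣ (filter (_∈ᶠ? D) (subsets n))

-- The first arguments of max and min are the values taken on the empty
-- list.  All sizes lie between 0 and n, so when D is proper they do not
-- affect the result, and r-min D ≤ r-max D, so that ∸ is true subtraction.
r-max r-min width : SetSystem n → ℕ
r-max     D = max 0 (feasibleSizes D)
r-min {n} D = min n (feasibleSizes D)
width     D = r-max D ∸ r-min D

-- There is always at least one subset, so the default 0 is harmless.
maxOverSubsets : (Subset n → ℕ) → ℕ
maxOverSubsets {n} f = max 0 (map f (subsets n))

{-# OPTIONS --safe #-}

-- If F is feasible then ∅ is feasible in D *×∣ F, so r-min (D *×∣ F) = 0 and
-- only r-max matters.  For arbitrary B two estimates hold:
--   * r-min (D *×∣ B) is at least the distance min { ∣ F △ B ∣ | F ∈ᶠ D };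
--   * r-max (D *×∣ B) is 1-Lipschitz in B for the metric ∣ A △ B ∣.
-- Hence passing from B to a feasible set nearest to it does not decrease the
-- width, and the maximum is attained on a feasible set.
module Submission where

open import Defs
open import Algebra.Bundles using (CommutativeRing)
open import Algebra.Properties.CommutativeSemigroup using (interchange)
open import Data.Bool using (Bool; true; false; T; T?; _xor_)
open import Data.Bool.Properties
  using (∨-identityʳ; xor-assoc; xor-same; xor-identityʳ; xor-∧-commutativeRing)
open import Data.Empty using (⊥-elim)
open import Data.Fin using (Fin; zero; suc)
open import Data.Fin.Subset using (Subset; inside; outside; _∪_; ⁅_⁆; ∣_∣; ⊥; _∉_)
open import Data.Fin.Subset.Properties
  using (_∈?_; anySubset?; ∣p∣≤n; ∣⊥∣≡0; ∪-identityʳ; drop-there)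
open import Data.List using (List; []; _∷_; filter; foldl; map; tabulate)
open import Data.List.Extrema.Nat
open import Data.List.Membership.Propositional using (_∈_)
open import Data.List.Membership.Propositional.Properties
  using (∈-map⁺; ∈-filter⁺; ∈-++⁺ˡ; ∈-++⁺ʳ)
import Data.List.Relation.Unary.All as All
open import Data.List.Relation.Unary.All.Properties using (all-filter; map⁺)
open import Data.List.Relation.Unary.Any using (here)
open import Data.Nat using (ℕ; zero; suc; _+_; _∸_; _≤_; z≤n; s≤s)
open import Data.Nat.Properties
  using (≤-refl; ≤-trans; ≤-reflexive; ≤-antisym; m≤n⇒m≤1+n; +-suc; +-monoˡ-≤; ∸-mono;
         m+n∸n≡m; n≤0⇒n≡0; module ≤-Reasoning)
open import Data.Product using (∃-syntax; _×_; _,_; proj₂)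
open import Data.Sum using (_⊎_; inj₁; inj₂)
open import Data.Unit using (tt)
open import Data.Vec using ([]; _∷_; here; there)
open import Data.Vec.Properties using (∷-injective)
open import Function using (_∘_; id; mk⇔)
open import Relation.Binary.PropositionalEquality
open import Relation.Nullary using (does; ¬?; _×-dec_)
open import Relation.Nullary.Decidable using (does-⇔)

private
  variable
    n : ℕ

-- Pointwise formulas for twist and loop complementation.

△-cancelʳ : (X A : Subset n) → (X △ A) △ A ≡ X
△-cancelʳ []      []      = refl
△-cancelʳ (x ∷ X) (a ∷ A) = cong₂ _∷_
  (trans (xor-assoc x a a) (trans (cong (x xor_) (xor-same a)) (xor-identityʳ x)))
  (△-cancelʳ X A)

-- Twisting by `A` is an involution on subsets, so `X △ A` is the only candidate for the searched
-- preimage of `X`.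
*∣-apply : (D : SetSystem n) (A X : Subset n) → (D *∣ A) X ≡ D (X △ A)
*∣-apply D A X = does-⇔
  (mk⇔ to (λ X△A∈D → X △ A , X△A∈D , sym (△-cancelʳ X A)))
  (anySubset? λ F → (F ∈ᶠ? D) ×-dec (X ≟ˢ F △ A))
  (T? (D (X △ A)))
  where
  to : ∃[ F ] (F ∈ᶠ D × X ≡ F △ A) → (X △ A) ∈ᶠ D
  to (F , F∈D , refl) = subst (_∈ᶠ D) (sym (△-cancelʳ F A)) F∈D

loopComplement-zero-outside : (D : SetSystem (suc n)) (X : Subset n) →
  (D loopComplement zero) (outside ∷ X) ≡ D (outside ∷ X)
loopComplement-zero-outside D X = trans
  (cong (D (outside ∷ X) xor_) (does-⇔
    (mk⇔ to λ ())
    (anySubset? λ F → (F ∈ᶠ? D) ×-dec ¬? (zero ∈? F) ×-dec ((outside ∷ X) ≟ˢ F ∪ ⁅ zero ⁆))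
    (T? false)))
  (xor-identityʳ _)
  where
  to : ∃[ F ] (F ∈ᶠ D × zero ∉ F × outside ∷ X ≡ F ∪ ⁅ zero ⁆) → T false
  to (true  ∷ F , _ , _ , ())
  to (false ∷ F , _ , _ , ())

loopComplement-zero-inside : (D : SetSystem (suc n)) (X : Subset n) →
  (D loopComplement zero) (inside ∷ X) ≡ D (inside ∷ X) xor D (outside ∷ X)
loopComplement-zero-inside D X = cong (D (inside ∷ X) xor_) (does-⇔
  (mk⇔ to (λ X∈D → outside ∷ X , X∈D , (λ ()) , cong (inside ∷_) (sym (∪-identityʳ X))))
  (anySubset? λ F → (F ∈ᶠ? D) ×-dec ¬? (zero ∈? F) ×-dec ((inside ∷ X) ≟ˢ F ∪ ⁅ zero ⁆))
  (T? (D (outside ∷ X))))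
  where
  to : ∃[ F ] (F ∈ᶠ D × zero ∉ F × inside ∷ X ≡ F ∪ ⁅ zero ⁆) → T (D (outside ∷ X))
  to (true  ∷ F , _   , 0∉F , _)  = ⊥-elim (0∉F here)
  to (false ∷ F , F∈D , _   , eq) = subst (λ Y → T (D (outside ∷ Y)))
    (sym (trans (proj₂ (∷-injective eq)) (∪-identityʳ F))) F∈D

-- Loop complementation at a later element never touches coordinate `zero`, so it acts on each of
-- the two slices separately. Since `E` is tied to `D` only by a pointwise equation, the conclusion
-- can serve as the hypothesis for the next element of a fold.
loopComplement-suc : (D : SetSystem (suc n)) (E : SetSystem n) (x : Bool) →
  (∀ X → D (x ∷ X) ≡ E X) → ∀ i X →
  (D loopComplement suc i) (x ∷ X) ≡ (E loopComplement i) X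
loopComplement-suc D E x D≗E i X = cong₂ _xor_ (D≗E X) (does-⇔ (mk⇔ to from)
  (anySubset? λ F → (F ∈ᶠ? D) ×-dec ¬? (suc i ∈? F) ×-dec ((x ∷ X) ≟ˢ F ∪ ⁅ suc i ⁆))
  (anySubset? λ F → (F ∈ᶠ? E) ×-dec ¬? (i ∈? F) ×-dec (X ≟ˢ F ∪ ⁅ i ⁆)))
  where
  to : ∃[ F ] (F ∈ᶠ D × suc i ∉ F × x ∷ X ≡ F ∪ ⁅ suc i ⁆) →
       ∃[ F ] (F ∈ᶠ E × i ∉ F × X ≡ F ∪ ⁅ i ⁆)
  -- Splitting on the head of `F` lets the head of the union reduce, so that `refl` identifies it
  -- with `x`.
  to (true  ∷ F , F∈D , i∉F , refl) = F , subst T (D≗E F) F∈D , i∉F ∘ there , refl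
  to (false ∷ F , F∈D , i∉F , refl) = F , subst T (D≗E F) F∈D , i∉F ∘ there , refl
  from : ∃[ F ] (F ∈ᶠ E × i ∉ F × X ≡ F ∪ ⁅ i ⁆) →
         ∃[ F ] (F ∈ᶠ D × suc i ∉ F × x ∷ X ≡ F ∪ ⁅ suc i ⁆)
  from (F , F∈E , i∉F , refl) =
    x ∷ F , subst T (sym (D≗E F)) F∈E , i∉F ∘ drop-there , cong (_∷ _) (sym (∨-identityʳ x))

-- Recursion for `_*×∣_`, one element at a time.

-- The index function is general because unfolding `tabulate` composes it with `suc`, and the
-- accumulators are general because the fold changes them. The head `a` is arbitrary, as no index of
-- the form `suc i` meets it.
foldl-loopComplement-suc : ∀ {m a} (A : Subset n) (f : Fin m → Fin n)
  (D : SetSystem (suc n)) (E : SetSystem n) x → (∀ X → D (x ∷ X) ≡ E X) → ∀ X →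
  foldl _loopComplement_ D (filter (_∈? (a ∷ A)) (tabulate (suc ∘ f))) (x ∷ X) ≡
  foldl _loopComplement_ E (filter (_∈? A) (tabulate f)) X
foldl-loopComplement-suc {m = zero}  A f D E x D≗E X = D≗E X
foldl-loopComplement-suc {m = suc m} A f D E x D≗E X with does (f zero ∈? A)
... | true  = foldl-loopComplement-suc A (f ∘ suc) _ _ x (loopComplement-suc D E x D≗E (f zero)) X
... | false = foldl-loopComplement-suc A (f ∘ suc) D E x D≗E X

×∣-outside : (A : Subset n) (D : SetSystem (suc n)) (E : SetSystem n) (x : Bool) →
  (∀ X → D (x ∷ X) ≡ E X) → ∀ X → (D ×∣ (outside ∷ A)) (x ∷ X) ≡ (E ×∣ A) X
×∣-outside A = foldl-loopComplement-suc A id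

-- Element `zero` comes first in increasing order, so its loop complementation is already done when
-- the rest of the fold starts to act slicewise.
×∣-inside : (A : Subset n) (D : SetSystem (suc n)) (E : SetSystem n) (x : Bool) →
  (∀ X → (D loopComplement zero) (x ∷ X) ≡ E X) → ∀ X →
  (D ×∣ (inside ∷ A)) (x ∷ X) ≡ (E ×∣ A) X
×∣-inside A D = foldl-loopComplement-suc A id (D loopComplement zero)

-- On an element e the operation *× replaces the pair of families
-- ({ F ∈ D | e ∉ F }, { F ∈ D | e ∈ F }), read as functions into GF(2), by
-- (second, first + second).
twistLoop : Subset n → SetSystem n → SetSystem n
twistLoop []            D []            = D []
twistLoop (outside ∷ A) D (x ∷ X)       = twistLoop A (λ Y → D (x ∷ Y)) X
twistLoop (inside ∷ A)  D (outside ∷ X) = twistLoop A (λ Y → D (inside ∷ Y)) X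
twistLoop (inside ∷ A)  D (inside ∷ X)  =
  twistLoop A (λ Y → D (outside ∷ Y) xor D (inside ∷ Y)) X

*×∣≗twistLoop : (A : Subset n) (D : SetSystem n) (X : Subset n) → (D *×∣ A) X ≡ twistLoop A D X
*×∣≗twistLoop []            D []            = *∣-apply D [] []
*×∣≗twistLoop (outside ∷ A) D (x ∷ X)       =
  trans (×∣-outside A (D *∣ (outside ∷ A)) (E *∣ A) x step X) (*×∣≗twistLoop A E X)
  where
  E = λ Y → D (x ∷ Y)
  step : ∀ Y → (D *∣ (outside ∷ A)) (x ∷ Y) ≡ (E *∣ A) Y
  step Y = trans (*∣-apply D (outside ∷ A) (x ∷ Y))
    (trans (cong (λ y → D (y ∷ Y △ A)) (xor-identityʳ x)) (sym (*∣-apply E A Y)))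
*×∣≗twistLoop (inside ∷ A)  D (outside ∷ X) =
  trans (×∣-inside A (D *∣ (inside ∷ A)) (E *∣ A) outside step X) (*×∣≗twistLoop A E X)
  where
  E = λ Y → D (inside ∷ Y)
  -- The twist has exchanged the two slices, and loop complementation at `zero` leaves the outside
  -- one alone.
  step : ∀ Y → ((D *∣ (inside ∷ A)) loopComplement zero) (outside ∷ Y) ≡ (E *∣ A) Y
  step Y = trans (loopComplement-zero-outside (D *∣ (inside ∷ A)) Y)
    (trans (*∣-apply D (inside ∷ A) (outside ∷ Y)) (sym (*∣-apply E A Y)))
*×∣≗twistLoop (inside ∷ A)  D (inside ∷ X)  =
  trans (×∣-inside A (D *∣ (inside ∷ A)) (E *∣ A) inside step X) (*×∣≗twistLoop A E X)
  where
  E = λ Y → D (outside ∷ Y) xor D (inside ∷ Y)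
  -- Here loop complementation adds the outside slice of the twist, which is the old inside slice.
  step : ∀ Y → ((D *∣ (inside ∷ A)) loopComplement zero) (inside ∷ Y) ≡ (E *∣ A) Y
  step Y = trans (loopComplement-zero-inside (D *∣ (inside ∷ A)) Y)
    (trans (cong₂ _xor_ (*∣-apply D (inside ∷ A) (inside ∷ Y))
                        (*∣-apply D (inside ∷ A) (outside ∷ Y)))
           (sym (*∣-apply E A Y)))

-- Linearity over GF(2) and estimates on sizes of feasible sets.

-- Every clause of `twistLoop` selects a slice or adds two slices, which is linear over GF(2).
twistLoop-xor : (A : Subset n) (D E : SetSystem n) (X : Subset n) →
  twistLoop A (λ Y → D Y xor E Y) X ≡ twistLoop A D X xor twistLoop A E X
twistLoop-xor []            D E []            = refl
twistLoop-xor (outside ∷ A) D E (x ∷ X)       = twistLoop-xor A _ _ X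
twistLoop-xor (inside ∷ A)  D E (outside ∷ X) = twistLoop-xor A _ _ X
twistLoop-xor (inside ∷ A)  D E (inside ∷ X)  = begin
  twistLoop A (λ Y → (D₀ Y xor E₀ Y) xor (D₁ Y xor E₁ Y)) X
    ≡⟨ twistLoop-xor A (λ Y → D₀ Y xor E₀ Y) (λ Y → D₁ Y xor E₁ Y) X ⟩
  twistLoop A (λ Y → D₀ Y xor E₀ Y) X xor twistLoop A (λ Y → D₁ Y xor E₁ Y) X
    ≡⟨ cong₂ _xor_ (twistLoop-xor A D₀ E₀ X) (twistLoop-xor A D₁ E₁ X) ⟩
  (twistLoop A D₀ X xor twistLoop A E₀ X) xor (twistLoop A D₁ X xor twistLoop A E₁ X)
    ≡⟨ interchange xor-commutativeSemigroup (twistLoop A D₀ X) _ _ _ ⟩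
  (twistLoop A D₀ X xor twistLoop A D₁ X) xor (twistLoop A E₀ X xor twistLoop A E₁ X)
    ≡⟨ cong₂ _xor_ (twistLoop-xor A D₀ D₁ X) (twistLoop-xor A E₀ E₁ X) ⟨
  twistLoop A (λ Y → D₀ Y xor D₁ Y) X xor twistLoop A (λ Y → E₀ Y xor E₁ Y) X ∎
  where
  open ≡-Reasoning
  D₀ = λ Y → D (outside ∷ Y)
  D₁ = λ Y → D (inside ∷ Y)
  E₀ = λ Y → E (outside ∷ Y)
  E₁ = λ Y → E (inside ∷ Y)
  xor-commutativeSemigroup = CommutativeRing.+-commutativeSemigroup xor-∧-commutativeRing

T-xor⁻ : ∀ x {y} → T (x xor y) → T x ⊎ T y
T-xor⁻ true  _ = inj₁ tt
T-xor⁻ false t = inj₂ t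

T⇒T⊎T-xor : ∀ {x} y → T x → T y ⊎ T (x xor y)
T⇒T⊎T-xor {true} true  _ = inj₁ tt
T⇒T⊎T-xor {true} false _ = inj₂ tt

-- At the empty set each clause picks the slice of `D` that agrees with `A` on the element.
twistLoop-⊥ : (A : Subset n) (D : SetSystem n) → twistLoop A D ⊥ ≡ D A
twistLoop-⊥ []            D = refl
twistLoop-⊥ (outside ∷ A) D = twistLoop-⊥ A _
twistLoop-⊥ (inside ∷ A)  D = twistLoop-⊥ A _

-- Off `A` the sets `F` and `X` agree. On `A`, an element missing from `X` is forced into `F` and
-- contributes nothing to the distance; an element of `X` leaves `F` free, at a cost of at most one.
twistLoop-distance : (A : Subset n) (D : SetSystem n) (X : Subset n) → X ∈ᶠ twistLoop A D →
  ∃[ F ] (F ∈ᶠ D × ∣ F △ A ∣ ≤ ∣ X ∣)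
twistLoop-distance []            D []            t = [] , t , ≤-refl
twistLoop-distance (outside ∷ A) D (outside ∷ X) t with twistLoop-distance A _ X t
... | F , F∈D , le = outside ∷ F , F∈D , le
twistLoop-distance (outside ∷ A) D (inside ∷ X)  t with twistLoop-distance A _ X t
... | F , F∈D , le = inside ∷ F , F∈D , s≤s le
twistLoop-distance (inside ∷ A)  D (outside ∷ X) t with twistLoop-distance A _ X t
... | F , F∈D , le = inside ∷ F , F∈D , le
twistLoop-distance (inside ∷ A)  D (inside ∷ X)  t with twistLoop-distance A _ X t
... | F , F∈D , le with T-xor⁻ (D (outside ∷ F)) F∈D
...   | inj₁ F∈D₀ = outside ∷ F , F∈D₀ , s≤s le
...   | inj₂ F∈D₁ = inside  ∷ F , F∈D₁ , m≤n⇒m≤1+n le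

-- Where `A` and `B` agree, `Y` copies the head of `X`. Where they differ, one side sees the slices
-- (u, v) and the other (v, u + v); a nonzero value in one pair gives a nonzero value in the other
-- at the same tail. Only the head of `Y` may then drop an element, and the extra one in the size of
-- `B △ A` pays for it.
twistLoop-lipschitz : (A B : Subset n) (D : SetSystem n) (X : Subset n) → X ∈ᶠ twistLoop A D →
  ∃[ Y ] (Y ∈ᶠ twistLoop B D × ∣ X ∣ ≤ ∣ Y ∣ + ∣ B △ A ∣)
twistLoop-lipschitz []            []            D []            t = [] , t , z≤n
twistLoop-lipschitz (outside ∷ A) (outside ∷ B) D (outside ∷ X) t
  with twistLoop-lipschitz A B _ X t
... | Y , Y∈ , le = outside ∷ Y , Y∈ , le
twistLoop-lipschitz (outside ∷ A) (outside ∷ B) D (inside ∷ X)  t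
  with twistLoop-lipschitz A B _ X t
... | Y , Y∈ , le = inside ∷ Y , Y∈ , s≤s le
twistLoop-lipschitz (inside ∷ A)  (inside ∷ B)  D (outside ∷ X) t
  with twistLoop-lipschitz A B _ X t
... | Y , Y∈ , le = outside ∷ Y , Y∈ , le
twistLoop-lipschitz (inside ∷ A)  (inside ∷ B)  D (inside ∷ X)  t
  with twistLoop-lipschitz A B _ X t
... | Y , Y∈ , le = inside ∷ Y , Y∈ , s≤s le
twistLoop-lipschitz (inside ∷ A)  (outside ∷ B) D (outside ∷ X) t
  with twistLoop-lipschitz A B _ X t
... | Y , Y∈ , le =
  inside ∷ Y , Y∈ , m≤n⇒m≤1+n (≤-trans (m≤n⇒m≤1+n le) (≤-reflexive (sym (+-suc ∣ Y ∣ _))))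
twistLoop-lipschitz (inside ∷ A)  (outside ∷ B) D (inside ∷ X)  t
  with twistLoop-lipschitz A B _ X t
... | Y , Y∈ , le
  with T-xor⁻ (twistLoop B (λ Z → D (outside ∷ Z)) Y) (subst T (twistLoop-xor B _ _ Y) Y∈)
...   | inj₁ Y∈₀ = outside ∷ Y , Y∈₀ , ≤-trans (s≤s le) (≤-reflexive (sym (+-suc ∣ Y ∣ _)))
...   | inj₂ Y∈₁ =
  inside ∷ Y , Y∈₁ , s≤s (≤-trans (m≤n⇒m≤1+n le) (≤-reflexive (sym (+-suc ∣ Y ∣ _))))
twistLoop-lipschitz (outside ∷ A) (inside ∷ B)  D (outside ∷ X) t
  with twistLoop-lipschitz A B _ X t
-- Over GF(2), if u = 1 then v and u + v cannot both vanish.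
... | Y , Y∈ , le with T⇒T⊎T-xor (twistLoop B (λ Z → D (inside ∷ Z)) Y) Y∈
...   | inj₁ Y∈₁ = outside ∷ Y , Y∈₁ , ≤-trans (m≤n⇒m≤1+n le) (≤-reflexive (sym (+-suc ∣ Y ∣ _)))
...   | inj₂ Y∈₊ =
  inside ∷ Y , subst T (sym (twistLoop-xor B _ _ Y)) Y∈₊ ,
  m≤n⇒m≤1+n (≤-trans (m≤n⇒m≤1+n le) (≤-reflexive (sym (+-suc ∣ Y ∣ _))))
twistLoop-lipschitz (outside ∷ A) (inside ∷ B)  D (inside ∷ X)  t
  with twistLoop-lipschitz A B _ X t
... | Y , Y∈ , le = outside ∷ Y , Y∈ , ≤-trans (s≤s le) (≤-reflexive (sym (+-suc ∣ Y ∣ _)))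

-- Extreme sizes of feasible sets.

∈-subsets : (X : Subset n) → X ∈ subsets n
∈-subsets []            = here refl
∈-subsets (outside ∷ X) = ∈-++⁺ˡ (∈-map⁺ (outside ∷_) (∈-subsets X))
∈-subsets (inside ∷ X)  = ∈-++⁺ʳ _ (∈-map⁺ (inside ∷_) (∈-subsets X))

feasibleSets : SetSystem n → List (Subset n)
feasibleSets {n} D = filter (_∈ᶠ? D) (subsets n)

∈-feasibleSets : (D : SetSystem n) {X : Subset n} → X ∈ᶠ D → X ∈ feasibleSets D
∈-feasibleSets D {X} X∈D = ∈-filter⁺ (_∈ᶠ? D) (∈-subsets X) X∈D

module _ (D : SetSystem n) where

  ∣X∣≤r-max : ∀ {X} → X ∈ᶠ D → ∣ X ∣ ≤ r-max D
  ∣X∣≤r-max X∈D = All.lookup (xs≤max 0 (feasibleSizes D)) (∈-map⁺ ∣_∣ (∈-feasibleSets D X∈D))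

  r-min≤∣X∣ : ∀ {X} → X ∈ᶠ D → r-min D ≤ ∣ X ∣
  r-min≤∣X∣ X∈D = All.lookup (min≤xs n (feasibleSizes D)) (∈-map⁺ ∣_∣ (∈-feasibleSets D X∈D))

  r-max≤ : ∀ {v} → (∀ {X} → X ∈ᶠ D → ∣ X ∣ ≤ v) → r-max D ≤ v
  r-max≤ h = max≤v⁺ z≤n (map⁺ (All.map h (all-filter (_∈ᶠ? D) (subsets n))))

  -- The bound `v ≤ n` covers the default value `n` of the minimum.
  ≤r-min : ∀ {v} → v ≤ n → (∀ {X} → X ∈ᶠ D → v ≤ ∣ X ∣) → v ≤ r-min D
  ≤r-min v≤n h = v≤min⁺ v≤n (map⁺ (All.map h (all-filter (_∈ᶠ? D) (subsets n))))

-- Comparison of widths.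

module _ (D : SetSystem n) where

  r-min-feasible : ∀ {F} → F ∈ᶠ D → r-min (D *×∣ F) ≡ 0
  r-min-feasible {F} F∈D = n≤0⇒n≡0 (≤-trans (r-min≤∣X∣ (D *×∣ F) ⊥∈) (≤-reflexive (∣⊥∣≡0 n)))
    where
    ⊥∈ : ⊥ ∈ᶠ (D *×∣ F)
    ⊥∈ = subst T (sym (trans (*×∣≗twistLoop F D ⊥) (twistLoop-⊥ F D))) F∈D

  r-max-lipschitz : ∀ A B → r-max (D *×∣ A) ≤ r-max (D *×∣ B) + ∣ B △ A ∣
  r-max-lipschitz A B = r-max≤ (D *×∣ A) bound
    where
    bound : ∀ {X} → X ∈ᶠ (D *×∣ A) → ∣ X ∣ ≤ r-max (D *×∣ B) + ∣ B △ A ∣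
    bound {X} X∈ with twistLoop-lipschitz A B D X (subst T (*×∣≗twistLoop A D X) X∈)
    ... | Y , Y∈ , le = ≤-trans le (+-monoˡ-≤ ∣ B △ A ∣
      (∣X∣≤r-max (D *×∣ B) (subst T (sym (*×∣≗twistLoop B D Y)) Y∈)))

  distance≤r-min : ∀ B {v} → v ≤ n → (∀ {F} → F ∈ᶠ D → v ≤ ∣ F △ B ∣) → v ≤ r-min (D *×∣ B)
  distance≤r-min B v≤n h = ≤r-min (D *×∣ B) v≤n bound
    where
    bound : ∀ {X} → X ∈ᶠ (D *×∣ B) → _ ≤ ∣ X ∣
    bound {X} X∈ with twistLoop-distance B D X (subst T (*×∣≗twistLoop B D X) X∈)
    ... | F , F∈D , le = ≤-trans (h F∈D) le

  width≤width-nearest : ∀ {F} B → F ∈ᶠ D → (∀ {G} → G ∈ᶠ D → ∣ F △ B ∣ ≤ ∣ G △ B ∣) →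
    width (D *×∣ B) ≤ width (D *×∣ F)
  width≤width-nearest {F} B F∈D nearest = begin
    r-max (D *×∣ B) ∸ r-min (D *×∣ B)
      -- The one number `∣ F △ B ∣` bounds both the possible loss in `r-max` and, because `F` is
      -- nearest to `B`, the value `r-min (D *×∣ B)` from below; the two cancel.
      ≤⟨ ∸-mono (r-max-lipschitz B F) (distance≤r-min B (∣p∣≤n (F △ B)) nearest) ⟩
    (r-max (D *×∣ F) + ∣ F △ B ∣) ∸ ∣ F △ B ∣
      ≡⟨ m+n∸n≡m (r-max (D *×∣ F)) ∣ F △ B ∣ ⟩
    r-max (D *×∣ F)
      ≡⟨ cong (r-max (D *×∣ F) ∸_) (r-min-feasible F∈D) ⟨
    r-max (D *×∣ F) ∸ r-min (D *×∣ F) ∎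
    where open ≤-Reasoning

  ∃-nearest : Proper D → ∀ B → ∃[ F ] (F ∈ᶠ D × (∀ {G} → G ∈ᶠ D → ∣ F △ B ∣ ≤ ∣ G △ B ∣))
  ∃-nearest (F₀ , F₀∈D) B =
    -- The default `F₀` is itself feasible, so the minimiser is feasible in every case.
    argmin distance F₀ (feasibleSets D) ,
    argmin-all distance F₀∈D (all-filter (_∈ᶠ? D) (subsets n)) ,
    λ G∈D → All.lookup (f[argmin]≤f[xs] {f = distance} F₀ (feasibleSets D)) (∈-feasibleSets D G∈D)
    where
    distance : Subset n → ℕ
    distance F = ∣ F △ B ∣

theorem3p1 : ∀ (n : ℕ) (D : SetSystem n) → Proper D →
    ∃[ F ] (F ∈ᶠ D × width (D *×∣ F) ≡ maxOverSubsets (λ (B : Subset n) → width (D *×∣ B)))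
theorem3p1 n D proper@(F₀ , F₀∈D) = F* , F*∈D , ≤-antisym
  (All.lookup (xs≤max 0 (map w (subsets n))) (∈-map⁺ w (∈-subsets F*)))
  -- `z≤n` deals with the default 0 of the maximum.
  (max≤v⁺ z≤n (map⁺ (All.tabulate {xs = subsets n} λ {B} _ → w≤w[F*] B)))
  where
  w : Subset n → ℕ
  w B = width (D *×∣ B)

  F* : Subset n
  -- The maximiser is taken over feasible sets only, so it does not depend on `B`; for each `B` it
  -- is compared with a feasible set nearest to `B`.
  F* = argmax w F₀ (feasibleSets D)

  F*∈D : F* ∈ᶠ D
  F*∈D = argmax-all w F₀∈D (all-filter (_∈ᶠ? D) (subsets n))

  w≤w[F*] : ∀ B → w B ≤ w F*
  w≤w[F*] B =
    let F , F∈D , nearest = ∃-nearest D proper B in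
    ≤-trans (width≤width-nearest D B F∈D nearest)
            (All.lookup (f[xs]≤f[argmax] {f = w} F₀ (feasibleSets D)) (∈-feasibleSets D F∈D))
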